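{- Let $0<n<\omega$, $k\ge2$, let $(C;\leq_0,\ldots,\leq_{n-1})$ be an $n$-preorder, $A:C\to\bar k$, and $F\in\mathcal{F}_k(n)$. Then $A\in\mathcal{C}(F)$ if and only if $T\leq_hF$ for every $T\in\mathcal{T}_k(n)$ with $T\leq_h (C;\leq_0,\ldots,\leq_{n-1},A)$.
   Context: $\bar k=\{0,\dots,k-1\}$. An $n$-preorder is a set $C$ with preorders $\le_0,\dots,\le_{n-1}$ such that $x\le_{i+1}y$ implies $x\equiv_i y$ (where $\equiv_i$ is the equivalence induced by $\le_i$). Its associated $n$-base is $\mathcal C=(\mathcal C_0,\dots,\mathcal C_{n-1})$, $\mathcal C_i$ = the family of $\le_i$-up subsets of $C$. Restricting to an $\equiv_0$-class $[c]_0$ gives the $(n-1)$-preorder $([c]_0;\le_1,\dots,\le_{n-1})$. Forests/trees: a forest is represented as a finite $F\subseteq\omega^+$ closed under nonempty prefixes, ordered by prefix; a tree as a finite prefix-closed $V\subseteq\omega^*$. For a preorder $Q$, $Q$-forests/trees carry labelings into $Q$, and $(P,c)\le_h(P',c')$ iff there is a monotone $\varphi:P\to P'$ with $c(x)\le c'(\varphi(x))$. $\mathcal T_k(0)=\bar k$ (antichain), $\mathcal T_k(m+1)$ = $\mathcal T_k(m)$-trees with $\le_h$; $\mathcal F_k(n)$ is the set of $\mathcal T_k(n-1)$-forests with $\le_h$. $T\le_h(C;\le_0,\dots,\le_{n-1},A)$ for $(T,t)\in\mathcal T_k(n)$ is defined recursively: for $n=1$, there is a monotone $\varphi:T\to(C;\le_0)$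 with $t(\tau)=A(\varphi(\tau))$ for all $\tau$; for $n>1$, there is a monotone $\varphi:T\to(C;\le_0)$ with $t(\tau)\le_h([\varphi(\tau)]_0;\le_1,\dots,\le_{n-1},A|_{[\varphi(\tau)]_0})$ for all $\tau\in T$. Fine hierarchy: for an $n$-base $\mathcal L=(\mathcal L_0,\dots,\mathcal L_{n-1})$ in a set $S$ (families closed under finite $\cup,\cap$, containing $\emptyset,S$) and $(F,c)\in\mathcal F_k(n)$, an $F$-family over $\mathcal L$ is $\{U_\tau\}_{\tau\in F}$ with $U_\tau\in\mathcal L_0$, $U_{\tau i}\subseteq U_\tau$, $\bigcup U_\tau=S$, together with (if $n>1$) for each $\tau$ a $c(\tau)$-family over the $(n-1)$-base $(\{\tilde U_\tau\cap B:B\in\mathcal L_1\},\dots,\{\tilde U_\tau\cap B:B\in\mathcal L_{n-1}\})$ in $\tilde U_\tau$, where $\tilde U_\tau=U_\tau\setminus\bigcup_{\tau i\in F}U_{\tau i}$ (for trees the same definition with $V\subseteq\omega^*$). It determines $A:S\to\bar k$ if: for $n=1$, $A(x)=c(\tau)$ whenever $x\in\tilde U_\tau$; for $n>1$, for every $\tau$, $A|_{\tilde U_\tau}$ is determined by the $c(\tau)$-family attached to $\tau$. $\mathcal C(F)$ is the set of $A:C\to\bar k$ determined by some $F$-family over the $n$-base $\mathcal C$. -}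

module Defs where

open import Level using (Level; 0ℓ; _⊔_) renaming (suc to lsuc)
open import Data.Fin.Base using (Fin; zero; suc; toℕ)
open import Data.List.Base using (List; []; _∷ʳ_)
open import Data.List.Membership.Propositional as List using ()
open import Data.List.Relation.Binary.Prefix.Heterogeneous using (Prefix)
open import Data.Nat.Base using (ℕ; zero; suc; pred; NonZero)
open import Data.Product.Base using (Σ; Σ-syntax; ∃; ∃-syntax; _×_; _,_; proj₁; proj₂)
open import Data.Refinement.Base using (Refinement-syntax; value)
open import Data.Sum.Base using (inj₁; inj₂) renaming (map to map-⊎)
open import Function.Base using (_∘_; _on_; id)
open import Relation.Binary.Construct.Interior.Symmetric using (SymInterior; _,_)
open import Relation.Binary.Core using (Rel; _Preserves_⟶_)
open import Relation.Binary.Structures using (IsPreorder)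
open import Relation.Binary.PropositionalEquality using (_≡_; _≢_; refl; cong; isEquivalence)
open import Relation.Unary using (Pred; _∈_; _⊆_; _≐_; _∪_; _∩_; _∖_; _⊢_; ⋃)
open import Relation.Unary.Polymorphic using (∅; U)

private
  variable
    a ℓ : Level
    n : ℕ
    Q : Set

record NPreorder (a : Level) (n : ℕ) : Set (lsuc a) where
  field
    Carrier    : Set a
    _≤[_]_     : Carrier → Fin n → Carrier → Set a
    isPreorder : ∀ i → IsPreorder _≡_ (_≤[ i ]_)

  _≈[_]_ : Carrier → Fin n → Carrier → Set a
  x ≈[ i ] y = SymInterior (_≤[ i ]_) x y

  field
    refines : ∀ {i j} → toℕ j ≡ suc (toℕ i) → ∀ {x y} → x ≤[ j ] y → x ≈[ i ] y

open NPreorder using (Carrier)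

-- ([ c ]₀; ≤₁, …, ≤ₙ); the surviving relations are renumbered from 0.
[_∣_]₀ : (C : NPreorder a (suc n)) → Carrier C → NPreorder a n
[ C ∣ c ]₀ = record
  { Carrier    = Σ[ x ∈ Carrier C ] x ≈[ zero ] c
  ; _≤[_]_     = λ x i y → proj₁ x ≤[ suc i ] proj₁ y
  ; isPreorder = λ i → record
    { isEquivalence = isEquivalence
    ; reflexive     = λ { refl → IsPreorder.refl (isPreorder (suc i)) }
    ; trans         = IsPreorder.trans (isPreorder (suc i))
    }
  ; refines    = λ e x≤y → let (p , q) = refines (cong suc e) x≤y in p , q
  }
  where open NPreorder C

-- A list of strings stands for the finite set of its members.  Membership is
-- irrelevant, so that order and repetitions in the list play no role and
-- labelings are functions of the string alone.
Node : List (List ℕ) → Set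
Node V = [ τ ∈ List ℕ ∣ τ List.∈ V ]

infix 4 _⊑_ _◂_

_⊑_ : ∀ {V} → Rel (Node V) 0ℓ
_⊑_ = Prefix _≡_ on value

-- σ ◂ τ: the string τ is σ i for some i ∈ ω.
_◂_ : ∀ {V} → Rel (Node V) 0ℓ
σ ◂ τ = ∃[ i ] value τ ≡ value σ ∷ʳ i

record Labelled (Q : Set) : Set where
  field
    nodes : List (List ℕ)
    label : Node nodes → Q

open Labelled using (nodes; label)

record Forest (Q : Set) : Set where
  field
    labelled : Labelled Q
    []∉      : [] List.∉ nodes labelled
    closed   : ∀ {σ τ} → σ ≢ [] → Prefix _≡_ σ τ →
               τ List.∈ nodes labelled → σ List.∈ nodes labelled

record Tree (Q : Set) : Set where
  field
    labelled : Labelled Q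
    []∈      : [] List.∈ nodes labelled
    closed   : ∀ {σ τ} → Prefix _≡_ σ τ →
               τ List.∈ nodes labelled → σ List.∈ nodes labelled

open Forest public using () renaming (labelled to ⌊_⌋ᶠ)
open Tree public using () renaming (labelled to ⌊_⌋ᵗ)

-- ≤ₕ with the labels compared by R.
Hom : Rel Q 0ℓ → Rel (Labelled Q) 0ℓ
Hom R P P′ = ∃[ φ ] φ Preserves _⊑_ ⟶ _⊑_ × (∀ τ → R (label P τ) (label P′ (φ τ)))

𝒯 : (k m : ℕ) → Set
𝒯 k zero    = Fin k
𝒯 k (suc m) = Tree (𝒯 k m)

𝓕 : (k n : ℕ) .{{_ : NonZero n}} → Set
𝓕 k n = Forest (𝒯 k (pred n))

module _ {k : ℕ} where

  ≤𝒯 : ∀ m → Rel (𝒯 k m) 0ℓ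
  ≤𝒯 zero    i j = i ≡ j
  ≤𝒯 (suc m) S T = Hom (≤𝒯 m) ⌊ S ⌋ᵗ ⌊ T ⌋ᵗ

  infix 4 _≤ₕ_ _≤ₕ⟨_,_⟩

  _≤ₕ_ : 𝒯 k (suc n) → 𝓕 k (suc n) → Set
  _≤ₕ_ {n} T F = Hom (≤𝒯 n) ⌊ T ⌋ᵗ ⌊ F ⌋ᶠ

  -- T ≤ₕ⟨ C , A ⟩ is T ≤ₕ (C; ≤₀, …, ≤ₙ, A).
  _≤ₕ⟨_,_⟩ : 𝒯 k (suc n) → (C : NPreorder a (suc n)) → (Carrier C → Fin k) → Set a
  _≤ₕ⟨_,_⟩ {zero} T C A =
    Σ[ φ ∈ (Node (nodes ⌊ T ⌋ᵗ) → Carrier C) ]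
      φ Preserves _⊑_ ⟶ (_≤[ zero ]_) ×
      (∀ τ → label ⌊ T ⌋ᵗ τ ≡ A (φ τ))
    where open NPreorder C
  _≤ₕ⟨_,_⟩ {suc n} T C A =
    Σ[ φ ∈ (Node (nodes ⌊ T ⌋ᵗ) → Carrier C) ]
      φ Preserves _⊑_ ⟶ (_≤[ zero ]_) ×
      (∀ τ → label ⌊ T ⌋ᵗ τ ≤ₕ⟨ [ C ∣ φ τ ]₀ , A ∘ proj₁ ⟩)
    where open NPreorder C

-- Subsets are predicates, so a family of subsets has to respect ≐.
record IsBase {S : Set a} (L : Pred (Pred S a) ℓ) : Set (lsuc a ⊔ ℓ) where
  field
    resp     : ∀ {X Y} → X ≐ Y → X ∈ L → Y ∈ L
    ∅∈       : ∅ ∈ L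
    U∈       : U ∈ L
    ∪-closed : ∀ {X Y} → X ∈ L → Y ∈ L → X ∪ Y ∈ L
    ∩-closed : ∀ {X Y} → X ∈ L → Y ∈ L → X ∩ Y ∈ L

record NBase {a} (ℓ : Level) (S : Set a) (n : ℕ) : Set (lsuc (a ⊔ ℓ)) where
  field
    family : Fin n → Pred (Pred S a) ℓ
    isBase : ∀ i → IsBase (family i)

open NBase using (family)

UpSet : (C : NPreorder a n) → Fin n → Pred (Pred (Carrier C) a) a
UpSet C i X = ∀ {x y} → x ≤[ i ] y → x ∈ X → y ∈ X
  where open NPreorder C

upSets : (C : NPreorder a n) → NBase a (Carrier C) n
upSets C = record
  { family = UpSet C
  ; isBase = λ i → record
    { resp     = λ (X⊆Y , Y⊆X) up x≤y → X⊆Y ∘ up x≤y ∘ Y⊆X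
    ; ∅∈       = λ _ → id
    ; U∈       = λ _ → id
    ; ∪-closed = λ up up′ x≤y → map-⊎ (up x≤y) (up′ x≤y)
    ; ∩-closed = λ up up′ x≤y (p , q) → up x≤y p , up′ x≤y q
    }
  }

-- ({D ∩ B : B ∈ L₁}, …, {D ∩ B : B ∈ Lₙ}), an n-base in D; as a subset of the
-- type Σ S D, the set D ∩ B is the preimage of B under proj₁.
restrict : {S : Set a} → NBase ℓ S (suc n) → (D : Pred S a) →
           NBase (lsuc a ⊔ ℓ) (Σ S D) n
restrict {S = S} L D = record
  { family = λ i X → ∃[ B ] B ∈ family L (suc i) × X ≐ (proj₁ ⊢ B)
  ; isBase = λ i → let open IsBase (NBase.isBase L (suc i)) in record
    { resp     = λ { (X⊆Y , Y⊆X) (B , B∈ , X⊆B , B⊆X) →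
                     B , B∈ , X⊆B ∘ Y⊆X , X⊆Y ∘ B⊆X }
    ; ∅∈       = ∅ , ∅∈ , id , id
    ; U∈       = U , U∈ , id , id
    ; ∪-closed = λ { (B , B∈ , X⊆B , B⊆X) (B′ , B′∈ , Y⊆B′ , B′⊆Y) →
                     B ∪ B′ , ∪-closed B∈ B′∈ ,
                     map-⊎ X⊆B Y⊆B′ , map-⊎ B⊆X B′⊆Y }
    ; ∩-closed = λ { (B , B∈ , X⊆B , B⊆X) (B′ , B′∈ , Y⊆B′ , B′⊆Y) →
                     B ∩ B′ , ∩-closed B∈ B′∈ ,
                     (λ (p , q) → X⊆B p , Y⊆B′ q) , (λ (p , q) → B⊆X p , B′⊆Y q) }
    }
  }

-- The sets U_τ of an F-family, without the families attached to the nodes.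
record Cover {S : Set a} (L₀ : Pred (Pred S a) ℓ) (P : Labelled Q) : Set (lsuc a ⊔ ℓ) where
  field
    set      : Node (nodes P) → Pred S a
    set∈     : ∀ τ → set τ ∈ L₀
    antitone : ∀ {σ τ} → σ ◂ τ → set τ ⊆ set σ
    covers   : ∀ x → x ∈ ⋃ (Node (nodes P)) set

  set~ : Node (nodes P) → Pred S a
  set~ σ = set σ ∖ ⋃ (∃ (σ ◂_)) (set ∘ proj₁)

open Cover using (set~)

module _ {k : ℕ} where

  Family : {S : Set a} → NBase ℓ S (suc n) → Labelled (𝒯 k n) → Set (lsuc a ⊔ ℓ)
  Family {n = zero}  L P = Cover (family L zero) P
  Family {n = suc n} L P = Σ[ 𝒰 ∈ Cover (family L zero) P ]
    (∀ τ → Family (restrict L (set~ 𝒰 τ)) ⌊ label P τ ⌋ᵗ)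

  Determines : {S : Set a} (L : NBase ℓ S (suc n)) (P : Labelled (𝒯 k n)) →
               Family L P → (S → Fin k) → Set a
  Determines {n = zero}  L P 𝒰       A = ∀ τ {x} → x ∈ set~ 𝒰 τ → A x ≡ label P τ
  Determines {n = suc n} L P (𝒰 , 𝒱) A = ∀ τ →
    Determines (restrict L (set~ 𝒰 τ)) ⌊ label P τ ⌋ᵗ (𝒱 τ) (A ∘ proj₁)

  𝒞⟨_⟩ : (C : NPreorder a (suc n)) → 𝓕 k (suc n) → Pred (Carrier C → Fin k) (lsuc a)
  𝒞⟨ C ⟩ F A = ∃[ 𝒰 ] Determines (upSets C) ⌊ F ⌋ᶠ 𝒰 A

{-# OPTIONS --safe #-}

-- If a cover determines A, then a tree placed in C is sent into F by moving up, along its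
-- branches, to nodes τ whose reduced set U~_τ contains the current point.  Conversely, let U_τ
-- consist of the points x such that every tree placed above x maps into the part of F above τ.
-- For each of the finitely many τ with x ∉ U_τ choose a tree witnessing this, and adjoin all of
-- them to a new root placed at x: the root of the resulting tree can only be sent to nodes τ
-- with x ∈ U_τ.  This yields both that the U_τ cover C and that labels fitting x ∈ U~_τ lie
-- below the label of τ; the families inside the U~_τ come by induction on n.
module Submission where

open import Axiom.ExcludedMiddle using (ExcludedMiddle)
open import Data.Empty using (⊥-elim; ⊥-elim-irr)
open import Data.Fin.Base using (Fin; zero; suc; inject₁)
open import Data.Fin.Induction using (<-weakInduction)
open import Data.Fin.Properties using (toℕ-inject₁)
open import Data.Irrelevant using ([_])
open import Data.List.Base using (List; []; _∷_; _∷ʳ_; _++_; map; length)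
open import Data.List.Extrema.Nat using (max; xs≤max)
open import Data.List.Membership.Propositional as List using ()
open import Data.List.Membership.Propositional.Properties
  using (∈-map⁺; ∈-map⁻; ∈-++⁺ˡ; ∈-++⁺ʳ; ∈-++⁻)
import Data.List.Membership.DecPropositional as DecMembership
open import Data.List.Properties using (≡-dec; length-++)
open import Data.List.Relation.Binary.Prefix.Heterogeneous using (Prefix; []; _∷_)
import Data.List.Relation.Binary.Prefix.Heterogeneous.Properties as Prefix
import Data.List.Relation.Binary.Pointwise as Pointwise
import Data.List.Relation.Unary.All as All
open import Data.List.Relation.Unary.Any using (here; there)
open import Data.Nat.Base using (ℕ; zero; suc; _+_; _≤_; _<_)
import Data.Nat.Properties as ℕ
open import Data.Product.Base using (Σ-syntax; ∃; ∃-syntax; _×_; _,_; proj₁; proj₂)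
open import Data.Refinement.Base using (value; _,_)
open import Data.Sum.Base using (_⊎_; inj₁; inj₂)
open import Function.Base using (_∘_; id)
open import Function.Bundles using (_⇔_; mk⇔)
open import Level using (Level; 0ℓ; Lift; lift; lower)
open import Relation.Binary.Construct.Interior.Symmetric using (SymInterior; _,_)
open import Relation.Binary.Core using (Rel; _Preserves_⟶_)
open import Relation.Binary.PropositionalEquality
  using (_≡_; _≢_; refl; sym; trans; cong; subst; isEquivalence)
open import Relation.Binary.Structures using (IsPreorder)
open import Relation.Nullary.Decidable using (yes; no; map′; recompute; decidable-stable)
open import Relation.Nullary.Negation using (¬_)
open import Relation.Unary using (Pred; _∈_; _∉_; _⊆_; _⊢_; ⋃)
open import Defs

open NPreorder using (Carrier)
open Labelled using (nodes; label)
open NBase using (family)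

private
  variable
    a s ℓ : Level
    k n : ℕ
    Q : Set

lower-excludedMiddle : ExcludedMiddle a → ExcludedMiddle 0ℓ
lower-excludedMiddle {a} em {X} = map′ lower lift (em {Lift a X})

-- Strings and nodes

prefix-refl : ∀ {σ : List ℕ} → Prefix _≡_ σ σ
prefix-refl = Prefix.fromPointwise (Pointwise.refl refl)

prefix-trans : ∀ {σ τ υ : List ℕ} → Prefix _≡_ σ τ → Prefix _≡_ τ υ → Prefix _≡_ σ υ
prefix-trans = Prefix.trans trans

prefix-∷ʳ : ∀ (σ : List ℕ) i → Prefix _≡_ σ (σ ∷ʳ i)
prefix-∷ʳ []      i = []
prefix-∷ʳ (_ ∷ σ) i = refl ∷ prefix-∷ʳ σ i

∷ʳ-nonempty : ∀ (σ : List ℕ) {i} → σ ∷ʳ i ≢ []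
∷ʳ-nonempty []      ()
∷ʳ-nonempty (_ ∷ _) ()

length-∷ʳ : ∀ (σ : List ℕ) i → length (σ ∷ʳ i) ≡ suc (length σ)
length-∷ʳ σ i = trans (length-++ σ) (ℕ.+-comm (length σ) 1)

prefix-split : ∀ {σ τ : List ℕ} → Prefix _≡_ σ τ → σ ≡ τ ⊎ ∃[ i ] Prefix _≡_ (σ ∷ʳ i) τ
prefix-split {τ = []}    [] = inj₁ refl
prefix-split {τ = i ∷ _} [] = inj₂ (i , refl ∷ [])
prefix-split (refl ∷ p) with prefix-split p
... | inj₁ refl    = inj₁ refl
... | inj₂ (i , q) = inj₂ (i , refl ∷ q)

-- Membership of a string in a finite list is decidable, so the irrelevant proof stored in a node
-- can be recomputed as a relevant one.
node-∈ : ∀ {V} (τ : Node V) → value τ List.∈ V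
node-∈ {V} (σ , [ σ∈ ]) = recompute (σ ∈? V) σ∈
  where open DecMembership (≡-dec ℕ._≟_) using (_∈?_)

height : List (List ℕ) → ℕ
height V = max 0 (map length V)

length≤height : ∀ {σ V} → σ List.∈ V → length σ ≤ height V
length≤height {V = V} σ∈ = All.lookup (xs≤max 0 (map length V)) (∈-map⁺ length σ∈)

⊑-refl : ∀ {V} {σ : Node V} → σ ⊑ σ
⊑-refl = prefix-refl

root : (T : Tree Q) → Node (nodes ⌊ T ⌋ᵗ)
root T = [] , [ Tree.[]∈ T ]

-- Common to the forests (no node []) and the trees (with node []).
ClosedUnderNonemptyPrefixes : Labelled Q → Set
ClosedUnderNonemptyPrefixes P = ∀ {σ τ} → σ ≢ [] → Prefix _≡_ σ τ →
  τ List.∈ nodes P → σ List.∈ nodes P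

treeClosed : (T : Tree Q) → ClosedUnderNonemptyPrefixes ⌊ T ⌋ᵗ
treeClosed T _ = Tree.closed T

-- Trees with one node, and adjoining a tree below the root

singleton : Q → Tree Q
singleton q = record
  { labelled = record { nodes = [] ∷ [] ; label = λ _ → q }
  ; []∈      = here refl
  ; closed   = λ { [] (here refl) → here refl }
  }

module _ (T T′ : Tree Q) where

  private
    V V′ : List (List ℕ)
    V  = nodes ⌊ T ⌋ᵗ
    V′ = nodes ⌊ T′ ⌋ᵗ

  -- Raising the first letter frees the letter 0 for the branch that carries `T′`; the root stays in
  -- place.
  shift : List ℕ → List ℕ
  shift []      = []
  shift (i ∷ σ) = suc i ∷ σ

  adjoinNodes : List (List ℕ)
  adjoinNodes = map shift V ++ map (0 ∷_) V′

  ∈-shift⁺ : ∀ {σ} → σ List.∈ V → shift σ List.∈ adjoinNodes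
  ∈-shift⁺ σ∈ = ∈-++⁺ˡ (∈-map⁺ shift σ∈)

  ∈-new⁺ : ∀ {σ} → σ List.∈ V′ → 0 ∷ σ List.∈ adjoinNodes
  ∈-new⁺ σ∈ = ∈-++⁺ʳ (map shift V) (∈-map⁺ (0 ∷_) σ∈)

  ∈-shift⁻ : ∀ {i σ} → suc i ∷ σ List.∈ adjoinNodes → i ∷ σ List.∈ V
  ∈-shift⁻ m with ∈-++⁻ (map shift V) m
  ∈-shift⁻ m | inj₁ m′ with ∈-map⁻ shift m′
  ∈-shift⁻ m | inj₁ m′ | (_ ∷ _) , τ∈ , refl = τ∈
  ∈-shift⁻ m | inj₂ m′ with ∈-map⁻ (0 ∷_) m′
  ∈-shift⁻ m | inj₂ m′ | _ , _ , ()

  ∈-new⁻ : ∀ {σ} → 0 ∷ σ List.∈ adjoinNodes → σ List.∈ V′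
  ∈-new⁻ m with ∈-++⁻ (map shift V) m
  ∈-new⁻ m | inj₁ m′ with ∈-map⁻ shift m′
  ∈-new⁻ m | inj₁ m′ | (_ ∷ _) , _ , ()
  ∈-new⁻ m | inj₂ m′ with ∈-map⁻ (0 ∷_) m′
  ∈-new⁻ m | inj₂ m′ | _ , τ∈ , refl = τ∈

  adjoinFold : {X : Set a} → (Node V → X) → (Node V′ → X) → Node adjoinNodes → X
  adjoinFold f g ([]        , _)     = f (root T)
  adjoinFold f g (zero  ∷ σ , [ m ]) = g (σ , [ ∈-new⁻ m ])
  adjoinFold f g (suc i ∷ σ , [ m ]) = f (i ∷ σ , [ ∈-shift⁻ m ])

  adjoin : Tree Q
  adjoin = record
    { labelled = record
      { nodes = adjoinNodes
      ; label = adjoinFold (label ⌊ T ⌋ᵗ) (label ⌊ T′ ⌋ᵗ)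
      }
    ; []∈      = ∈-shift⁺ (Tree.[]∈ T)
    ; closed   = closed
    }
    where
    closed : ∀ {σ τ} → Prefix _≡_ σ τ → τ List.∈ adjoinNodes → σ List.∈ adjoinNodes
    closed []                 _ = ∈-shift⁺ (Tree.[]∈ T)
    closed {zero  ∷ _} (refl ∷ p) m = ∈-new⁺ (Tree.closed T′ p (∈-new⁻ m))
    closed {suc _ ∷ _} (refl ∷ p) m = ∈-shift⁺ (Tree.closed T (refl ∷ p) (∈-shift⁻ m))

  adjoinFold-mono : {X : Set a} {_≲_ : Rel X ℓ} {f : Node V → X} {g : Node V′ → X} →
    (∀ {x} → x ≲ x) → f Preserves _⊑_ ⟶ _≲_ → g Preserves _⊑_ ⟶ _≲_ →
    (∀ τ → f (root T) ≲ g τ) → adjoinFold f g Preserves _⊑_ ⟶ _≲_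
  adjoinFold-mono rfl fm gm fg {[] , _}        {[] , _}        p          = rfl
  adjoinFold-mono rfl fm gm fg {[] , _}        {zero  ∷ τ , _} p          = fg _
  adjoinFold-mono rfl fm gm fg {[] , _}        {suc i ∷ τ , _} p          = fm []
  adjoinFold-mono rfl fm gm fg {zero  ∷ σ , _} {_ ∷ τ , _}     (refl ∷ p) = gm p
  adjoinFold-mono rfl fm gm fg {suc i ∷ σ , _} {_ ∷ τ , _}     (refl ∷ p) = fm (refl ∷ p)

  inˡ : Node V → Node adjoinNodes
  inˡ (σ , [ σ∈ ]) = shift σ , [ ∈-shift⁺ σ∈ ]

  inʳ : Node V′ → Node adjoinNodes
  inʳ (σ , [ σ∈ ]) = 0 ∷ σ , [ ∈-new⁺ σ∈ ]

  inˡ-mono : inˡ Preserves _⊑_ ⟶ _⊑_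
  inˡ-mono             []         = []
  inˡ-mono {_ ∷ _ , _} (refl ∷ p) = refl ∷ p

  inʳ-mono : inʳ Preserves _⊑_ ⟶ _⊑_
  inʳ-mono p = refl ∷ p

  adjoinFold-inˡ : {X : Set a} (f : Node V → X) (g : Node V′ → X) →
    ∀ τ → adjoinFold f g (inˡ τ) ≡ f τ
  adjoinFold-inˡ f g ([]    , _) = refl
  adjoinFold-inˡ f g (_ ∷ _ , _) = refl

  hom-inˡ : (R : Rel Q 0ℓ) (P : Labelled Q) → Hom R ⌊ adjoin ⌋ᵗ P → Hom R ⌊ T ⌋ᵗ P
  hom-inˡ R P (ψ , mono , lab) = ψ ∘ inˡ , (λ {σ} {τ} p → mono (inˡ-mono {σ} {τ} p)) , λ τ →
    subst (λ q → R q (label P (ψ (inˡ τ)))) (adjoinFold-inˡ _ _ τ) (lab (inˡ τ))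

  hom-inʳ : (R : Rel Q 0ℓ) (P : Labelled Q) → Hom R ⌊ adjoin ⌋ᵗ P → Hom R ⌊ T′ ⌋ᵗ P
  hom-inʳ R P (ψ , mono , lab) = ψ ∘ inʳ , (λ {σ} {τ} p → mono (inʳ-mono {σ} {τ} p)) , lab ∘ inʳ

-- Placements of trees in n-preorders

module _ (C : NPreorder a (suc n)) where
  open NPreorder C

  ≤⇒≤₀ : ∀ i {x y} → x ≤[ i ] y → x ≤[ zero ] y
  ≤⇒≤₀ = <-weakInduction (λ i → ∀ {x y} → x ≤[ i ] y → x ≤[ zero ] y) id
    (λ i ih x≤y → ih (SymInterior.lhs≤rhs (refines (cong suc (sym (toℕ-inject₁ i))) x≤y)))

  ≤⇒≈₀ : ∀ i {x y} → x ≤[ suc i ] y → x ≈[ zero ] y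
  ≤⇒≈₀ i x≤y with refines {inject₁ i} (cong suc (sym (toℕ-inject₁ i))) x≤y
  ... | p , q = ≤⇒≤₀ (inject₁ i) p , ≤⇒≤₀ (inject₁ i) q

-- The condition on a single label in `_≤ₕ⟨_,_⟩`, uniform in its two clauses, so that later
-- arguments on placements need not split on `n`.
Fits : (C : NPreorder a (suc n)) (A : Carrier C → Fin k) → 𝒯 k n → Carrier C → Set a
Fits {a = a} {n = zero}  C A t x = Lift a (t ≡ A x)
Fits {n = suc n} C A t x = t ≤ₕ⟨ [ C ∣ x ]₀ , A ∘ proj₁ ⟩

Placement : (C : NPreorder a (suc n)) (A : Carrier C → Fin k) → 𝒯 k (suc n) → Set a
Placement C A T = Σ[ φ ∈ (Node (nodes ⌊ T ⌋ᵗ) → Carrier C) ]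
  φ Preserves _⊑_ ⟶ (_≤[ zero ]_) × (∀ τ → Fits C A (label ⌊ T ⌋ᵗ τ) (φ τ))
  where open NPreorder C

≤ₕ⇒placement : ∀ n (C : NPreorder a (suc n)) (A : Carrier C → Fin k) (T : 𝒯 k (suc n)) →
  T ≤ₕ⟨ C , A ⟩ → Placement C A T
≤ₕ⇒placement zero    C A T (φ , mono , lab) = φ , mono , lift ∘ lab
≤ₕ⇒placement (suc n) C A T h                = h

placement⇒≤ₕ : ∀ n (C : NPreorder a (suc n)) (A : Carrier C → Fin k) (T : 𝒯 k (suc n)) →
  Placement C A T → T ≤ₕ⟨ C , A ⟩
placement⇒≤ₕ zero    C A T (φ , mono , lab) = φ , mono , lower ∘ lab
placement⇒≤ₕ (suc n) C A T h                = h

≤ₕ-map : ∀ n (C D : NPreorder a (suc n)) (f : Carrier C → Carrier D) →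
  (∀ i {x y} → NPreorder._≤[_]_ C x i y → NPreorder._≤[_]_ D (f x) i (f y)) →
  (A : Carrier D → Fin k) (T : 𝒯 k (suc n)) → T ≤ₕ⟨ C , A ∘ f ⟩ → T ≤ₕ⟨ D , A ⟩
≤ₕ-map zero    C D f f-mono A T (φ , mono , lab) = f ∘ φ , f-mono zero ∘ mono , lab
≤ₕ-map (suc n) C D f f-mono A T (φ , mono , lab) = f ∘ φ , f-mono zero ∘ mono , λ τ →
  ≤ₕ-map n [ C ∣ φ τ ]₀ [ D ∣ f (φ τ) ]₀
    (λ { (y , p , q) → f y , f-mono zero p , f-mono zero q })
    (λ i → f-mono (suc i)) (A ∘ proj₁) (label ⌊ T ⌋ᵗ τ) (lab τ)

-- Nested one-node trees, all placed at `x`, with `A x` at the innermost level.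
singleton-fits : ∀ n (C : NPreorder a (suc n)) (A : Carrier C → Fin k) x →
  Σ[ t ∈ 𝒯 k n ] Fits C A t x
singleton-fits zero    C A x = A x , lift refl
singleton-fits (suc n) C A x = singleton t , placement⇒≤ₕ n _ _ (singleton t)
  ((λ _ → x₀) , (λ _ → IsPreorder.refl (NPreorder.isPreorder C (suc zero))) , (λ _ → t-fits))
  where
  x₀ : Carrier [ C ∣ x ]₀
  x₀ = x , IsPreorder.refl (NPreorder.isPreorder C zero)
         , IsPreorder.refl (NPreorder.isPreorder C zero)
  t : 𝒯 _ n
  t = proj₁ (singleton-fits n [ C ∣ x ]₀ (A ∘ proj₁) x₀)
  t-fits : Fits [ C ∣ x ]₀ (A ∘ proj₁) t x₀
  t-fits = proj₂ (singleton-fits n [ C ∣ x ]₀ (A ∘ proj₁) x₀)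

-- The domain for the induction on `n`: a reduced set `set~` may consist of many
-- `≈[ zero ]`-classes, whereas `[_∣_]₀` handles a single one.
subPreorder : (C : NPreorder a (suc n)) → Pred (Carrier C) a → NPreorder a n
subPreorder C D = record
  { Carrier    = ∃ D
  ; _≤[_]_     = λ x i y → proj₁ x ≤[ suc i ] proj₁ y
  ; isPreorder = λ i → record
    { isEquivalence = isEquivalence
    ; reflexive     = λ { refl → IsPreorder.refl (isPreorder (suc i)) }
    ; trans         = IsPreorder.trans (isPreorder (suc i))
    }
  ; refines    = λ e x≤y → let (p , q) = refines (cong suc e) x≤y in p , q
  }
  where open NPreorder C

-- A tree is connected, so its image under a ≤₁-monotone map lies in one ≡₀-class.
subPreorder-fits : ∀ n (C : NPreorder a (suc (suc n))) (A : Carrier C → Fin k)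
  (D : Pred (Carrier C) a) (T : 𝒯 k (suc n)) →
  T ≤ₕ⟨ subPreorder C D , A ∘ proj₁ ⟩ → ∃[ x ] x ∈ D × Fits C A T x
subPreorder-fits {k = k} n C A D T h = x , proj₂ (φ (root T)) ,
    placement⇒≤ₕ n _ _ T (φ′ , φ-mono , λ τ → fits n C A D (φ≈x τ) (φ-fits τ))
  where
  open NPreorder C
  place = ≤ₕ⇒placement n (subPreorder C D) (A ∘ proj₁) T h
  φ = proj₁ place
  φ-mono = proj₁ (proj₂ place)
  φ-fits = proj₂ (proj₂ place)
  x = proj₁ (φ (root T))
  φ≈x : ∀ τ → proj₁ (φ τ) ≈[ zero ] x
  φ≈x τ with ≤⇒≈₀ C zero (φ-mono {root T} {τ} [])
  ... | p , q = q , p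
  φ′ : Node (nodes ⌊ T ⌋ᵗ) → Carrier [ C ∣ x ]₀
  φ′ τ = proj₁ (φ τ) , φ≈x τ
  fits : ∀ n (C : NPreorder _ (suc (suc n))) (A : Carrier C → Fin k) (D : Pred (Carrier C) _)
    {x : Carrier C} {t : 𝒯 k n} {y : ∃ D} (y≈x : NPreorder._≈[_]_ C (proj₁ y) zero x) →
    Fits (subPreorder C D) (A ∘ proj₁) t y → Fits [ C ∣ x ]₀ (A ∘ proj₁) t (proj₁ y , y≈x)
  fits zero    C A D y≈x (lift e) = lift e
  -- A point equivalent to `y` at level 1 is also equivalent to `y`, hence to `x`, at level 0, so
  -- the class of `y` maps into the smaller preorder on the class of `x`.
  fits (suc n) C A D {x} {t} {y} (p , q) = ≤ₕ-map n [ subPreorder C D ∣ y ]₀ [ [ C ∣ x ]₀ ∣ _ ]₀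
    (λ { ((z , _) , r , r′) → (z , ≤-trans (≤⇒≤₀ C _ r) p , ≤-trans q (≤⇒≤₀ C _ r′)) , r , r′ })
    (λ i → id) (A ∘ proj₁ ∘ proj₁) t
    where
    ≤-trans = IsPreorder.trans (NPreorder.isPreorder C zero)

-- From a determining family to homomorphisms

module _ (em : ExcludedMiddle s) {S : Set s} {L₀ : Pred (Pred S s) ℓ} {P : Labelled Q}
         (𝒰 : Cover L₀ P) where
  open Cover 𝒰

  -- Passing to a child whose set contains `x` lengthens the string by one and lowers `e` by one,
  -- which preserves the bound. At `e = 0` the string would exceed the height.
  climb′ : ∀ x e p → .(height (nodes P) < length (value p) + e) → x ∈ set p →
    ∃[ q ] p ⊑ q × x ∈ set~ q
  climb′ x zero (σ , [ σ∈ ]) h<p x∈ = ⊥-elim-irr (ℕ.<⇒≱ h<p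
    (subst (_≤ _) (sym (ℕ.+-identityʳ _)) (length≤height σ∈)))
  climb′ x (suc e) p h<p x∈ with em {x ∈ ⋃ (∃ (p ◂_)) (set ∘ proj₁)}
  ... | no ∉children = p , ⊑-refl {σ = p} , x∈ , ∉children
  ... | yes (((.(value p ∷ʳ i) , σ∈) , i , refl) , x∈′) =
    let (q , p⊑q , x∈q) = climb′ x e _
          (subst (height (nodes P) <_)
            (trans (ℕ.+-suc _ e) (cong (_+ e) (sym (length-∷ʳ (value p) i)))) h<p) x∈′
    in q , prefix-trans (prefix-∷ʳ (value p) i) p⊑q , x∈q

  climb : ∀ x p → x ∈ set p → ∃[ q ] p ⊑ q × x ∈ set~ q
  climb x p = climb′ x (suc (height (nodes P))) p
    (ℕ.m≤n+m (suc (height (nodes P))) (length (value p)))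

  PrefixClosed : Pred (List ℕ) 0ℓ → Set
  PrefixClosed V = ∀ {σ τ} → Prefix _≡_ σ τ → V τ → V σ

  Persistent : (V : Pred (List ℕ) 0ℓ) → (∀ σ → .(V σ) → S) → Set s
  Persistent V g = ∀ {σ τ} .(v : V σ) .(w : V τ) → Prefix _≡_ σ τ →
    ∀ p → g σ v ∈ set p → g τ w ∈ set p

  -- The climb for each string starts where that of its parent ended. The recursion strips the first
  -- letter and continues in the subtree below it; this is why `V` is a predicate on strings and not
  -- a list of nodes.
  walk : ∀ {V} → PrefixClosed V → (g : ∀ σ → .(V σ) → S) → Persistent V g →
    ∀ p → (∀ .v → g [] v ∈ set p) → ∀ τ .(v : V τ) →
    ∃[ q ] p ⊑ q × g τ v ∈ set~ q
  walk cl g pers p m []      v = climb (g [] v) p (m v)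
  walk cl g pers p m (i ∷ τ) v =
    let (q , p⊑q , x∈q)  = climb (g [] (cl [] v)) p (m (cl [] v))
        (r , q⊑r , x∈r) = walk (λ π → cl (refl ∷ π)) (λ σ → g (i ∷ σ))
          (λ v w π → pers v w (refl ∷ π)) q
          (λ w → pers (cl [] v) w [] q (proj₁ x∈q)) τ v
    in r , prefix-trans p⊑q q⊑r , x∈r

  -- Along their common prefix both walks make the same choices, since the points do not depend on
  -- the proofs of membership; after that the longer walk only moves up.
  walk-mono : ∀ {V} (cl : PrefixClosed V) (g : ∀ σ → .(V σ) → S) (pers : Persistent V g) →
    ∀ p (m : ∀ .v → g [] v ∈ set p) {σ τ} .(v : V σ) .(w : V τ) → Prefix _≡_ σ τ →
    proj₁ (walk cl g pers p m σ v) ⊑ proj₁ (walk cl g pers p m τ w)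
  walk-mono cl g pers p m {τ = []}    v w [] =
    ⊑-refl {σ = proj₁ (walk cl g pers p m [] v)}
  walk-mono cl g pers p m {τ = i ∷ τ} v w [] =
    proj₁ (proj₂ (walk (λ π → cl (refl ∷ π)) (λ σ → g (i ∷ σ)) _ _ _ τ w))
  walk-mono cl g pers p m {i ∷ σ} {i ∷ τ} v w (refl ∷ π) =
    walk-mono (λ π → cl (refl ∷ π)) (λ σ → g (i ∷ σ)) _ _ _ v w π

  cover-map : (T : Tree Q) (g : Node (nodes ⌊ T ⌋ᵗ) → S) →
    (∀ {σ τ} → σ ⊑ τ → ∀ p → g σ ∈ set p → g τ ∈ set p) →
    Σ[ ψ ∈ (Node (nodes ⌊ T ⌋ᵗ) → Node (nodes P)) ]
      ψ Preserves _⊑_ ⟶ _⊑_ × (∀ τ → g τ ∈ set~ (ψ τ))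
  cover-map T g pers =
      (λ { (σ , [ v ]) → proj₁ (walk′ σ v) })
    , (λ { {σ , [ v ]} {τ , [ w ]} π → walk-mono (Tree.closed T) g′ pers′ p m v w π })
    , (λ { (σ , [ v ]) → proj₂ (proj₂ (walk′ σ v)) })
    where
    g′ : ∀ σ → .(σ List.∈ nodes ⌊ T ⌋ᵗ) → S
    g′ σ v = g (σ , [ v ])
    pers′ : Persistent (List._∈ nodes ⌊ T ⌋ᵗ) g′
    pers′ v w π = pers π
    p = proj₁ (covers (g (root T)))
    m : ∀ .v → g′ [] v ∈ set p
    m _ = proj₂ (covers (g (root T)))
    walk′ = walk (Tree.closed T) g′ pers′ p m

-- The base lives on a set `S` into which `C` is mapped by `f`: in the induction the inner family
-- covers a whole reduced set, while the inner tree is placed in one class contained in it.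
sound : ExcludedMiddle a → ∀ n {S : Set a} (L : NBase ℓ S (suc n)) (P : Labelled (𝒯 k n)) 𝒰
  (A : S → Fin k) → Determines L P 𝒰 A →
  (C : NPreorder a (suc n)) (f : Carrier C → S) →
  (∀ i {X} → X ∈ family L i → f ⊢ X ∈ UpSet C i) →
  (T : 𝒯 k (suc n)) → T ≤ₕ⟨ C , A ∘ f ⟩ → Hom (≤𝒯 n) ⌊ T ⌋ᵗ P
sound em zero L P 𝒰 A det C f up T (φ , φ-mono , lab) =
  let (ψ , ψ-mono , ∈~) = cover-map em 𝒰 T (f ∘ φ)
        (λ π p → up zero (Cover.set∈ 𝒰 p) (φ-mono π))
  in ψ , (λ {σ} {τ} → ψ-mono {σ} {τ}) , λ τ → trans (lab τ) (det (ψ τ) (∈~ τ))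
sound em (suc n) L P (𝒰 , 𝒱) A det C f up T (φ , φ-mono , lab) =
  let (ψ , ψ-mono , ∈~) = cover-map em 𝒰 T (f ∘ φ)
        (λ π p → up zero (set∈ p) (φ-mono π))
  in ψ , (λ {σ} {τ} → ψ-mono {σ} {τ}) , λ τ →
    sound em n (restrict L (set~ (ψ τ))) ⌊ label P (ψ τ) ⌋ᵗ (𝒱 (ψ τ)) (A ∘ proj₁) (det (ψ τ))
      [ C ∣ φ τ ]₀
      (λ { (y , y≈) → f y , set~-≈ y≈ (∈~ τ) })
      (λ { i (B , B∈ , X⊆B , B⊆X) y≤z → B⊆X ∘ up (suc i) B∈ y≤z ∘ X⊆B })
      (label ⌊ T ⌋ᵗ τ) (lab τ)
  where
  open Cover 𝒰
  -- Both the set of `ρ` and those of its children pull back to up-sets, so a class is never divided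
  -- by a reduced set.
  set~-≈ : ∀ {x y ρ} → NPreorder._≈[_]_ C y zero x → f x ∈ set~ ρ → f y ∈ set~ ρ
  set~-≈ {ρ = ρ} (y≤x , x≤y) (x∈ , x∉) = up zero (set∈ ρ) x≤y x∈ ,
    λ { (τ , y∈) → x∉ (τ , up zero (set∈ (proj₁ τ)) y≤x y∈) }

-- From homomorphisms to a determining family

module _ (em : ExcludedMiddle a) {n : ℕ} (C : NPreorder a (suc n)) (A : Carrier C → Fin k)
         (P : Labelled (𝒯 k n)) where
  open NPreorder C
  open IsPreorder (isPreorder zero) using () renaming (refl to ≤-refl; trans to ≤-trans)

  HomAbove : Node (nodes P) → 𝒯 k (suc n) → Set
  HomAbove ρ T = Σ[ h ∈ Hom (≤𝒯 n) ⌊ T ⌋ᵗ P ] (∀ τ → ρ ⊑ proj₁ h τ)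

  PlacedAbove : Carrier C → 𝒯 k (suc n) → Set a
  PlacedAbove x T = Σ[ p ∈ Placement C A T ] (∀ τ → x ≤[ zero ] proj₁ p τ)

  above : Node (nodes P) → Pred (Carrier C) a
  above ρ x = ∀ T → PlacedAbove x T → HomAbove ρ T

  above-up : ∀ ρ → above ρ ∈ UpSet C zero
  above-up ρ x≤y x∈ T (p , y≤) = x∈ T (p , λ τ → ≤-trans x≤y (y≤ τ))

  above-antitone : ∀ ρ τ → ρ ⊑ τ → above τ ⊆ above ρ
  above-antitone ρ τ ρ⊑τ x∈ T p = let (h , τ⊑) = x∈ T p in h , λ υ → prefix-trans ρ⊑τ (τ⊑ υ)

  counterexample : ∀ {ρ x} → x ∉ above ρ → ∃[ T ] PlacedAbove x T × ¬ HomAbove ρ T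
  counterexample x∉ = decidable-stable em λ none → x∉ λ T p →
    decidable-stable (lower-excludedMiddle em) λ ¬h → none (T , p , ¬h)

  PlacedAt : Carrier C → 𝒯 k n → 𝒯 k (suc n) → Set a
  PlacedAt x t T = Σ[ p ∈ Placement C A T ]
    proj₁ p (root T) ≡ x × label ⌊ T ⌋ᵗ (root T) ≡ t

  placedAt⇒above : ∀ {x t} T → PlacedAt x t T → PlacedAbove x T
  placedAt⇒above T (p@(φ , φ-mono , _) , refl , _) = p , λ τ → φ-mono {root T} {τ} []

  adjoin-placed : ∀ {x t} T T′ → PlacedAt x t T → PlacedAbove x T′ → PlacedAt x t (adjoin T T′)
  adjoin-placed T T′ ((φ , φ-mono , φ-fits) , refl , refl) ((φ′ , φ′-mono , φ′-fits) , x≤) =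
    ( adjoinFold T T′ φ φ′
    , (λ {σ} {τ} → adjoinFold-mono T T′ {_≲_ = _≤[ zero ]_} ≤-refl φ-mono φ′-mono x≤ {σ} {τ})
    , fits ) , refl , refl
    where
    fits : ∀ τ → Fits C A (label ⌊ adjoin T T′ ⌋ᵗ τ) (adjoinFold T T′ φ φ′ τ)
    fits ([]        , _) = φ-fits _
    fits (zero  ∷ _ , _) = φ′-fits _
    fits (suc _ ∷ _ , _) = φ-fits _

  -- Induction on the strings still to be excluded as bad images of the root. A counterexample is
  -- adjoined when the string is a node outside whose `above` set `x` lies; otherwise the tree is
  -- left as it is.
  testTree : ∀ {x t} → Fits C A t x → (W : List (List ℕ)) →
    Σ[ T ∈ 𝒯 k (suc n) ] PlacedAt x t T ×
      ((h : Hom (≤𝒯 n) ⌊ T ⌋ᵗ P) → value (proj₁ h (root T)) List.∈ W →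
        x ∈ above (proj₁ h (root T)))
  testTree {x} {t} t-fits [] =
    singleton t , (((λ _ → x) , (λ _ → ≤-refl) , λ _ → t-fits) , refl , refl) , λ _ ()
  testTree {x} {t} t-fits (σ ∷ W) with testTree t-fits W
                                     | em {∃[ ρ ] value ρ ≡ σ × x ∉ above ρ}
  ... | T , placed , test | no none = T , placed , λ
    { h (here e)  → decidable-stable em λ x∉ → none (proj₁ h (root T) , e , x∉)
    ; h (there m) → test h m
    }
  ... | T , placed , test | yes (ρ , refl , x∉) with counterexample {ρ} x∉
  ...   | T′ , placed′ , ¬hom = adjoin T T′ , adjoin-placed T T′ placed placed′ , λ
    -- If the root went to `ρ`, the whole new branch would be mapped above `ρ`, which `T′` forbids.
    { h@(ψ , ψ-mono , _) (here e) → ⊥-elim (¬hom (hom-inʳ T T′ (≤𝒯 n) P h , λ τ →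
        subst (λ σ → Prefix _≡_ σ (value (ψ (inʳ T T′ τ)))) e
          (ψ-mono {root (adjoin T T′)} {inʳ T T′ τ} [])))
    -- Restriction along `inˡ` keeps the image of the root, so the earlier exclusions persist.
    ; h (there m) → test (hom-inˡ T T′ (≤𝒯 n) P h) m
    }

  root∈above : ∀ {x t} → Fits C A t x → Σ[ T ∈ 𝒯 k (suc n) ] PlacedAt x t T ×
    ((h : Hom (≤𝒯 n) ⌊ T ⌋ᵗ P) → x ∈ above (proj₁ h (root T)))
  root∈above t-fits with testTree t-fits (nodes P)
  ... | T , placed , test = T , placed , λ h → test h (node-∈ (proj₁ h (root T)))

  module _ (closed : ClosedUnderNonemptyPrefixes P)
           (homs : (T : 𝒯 k (suc n)) → T ≤ₕ⟨ C , A ⟩ → Hom (≤𝒯 n) ⌊ T ⌋ᵗ P) where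

    aboveCover : {L₀ : Pred (Pred (Carrier C) a) ℓ} →
      (∀ {X} → X ∈ UpSet C zero → X ∈ L₀) → Cover L₀ P
    aboveCover up∈ = record
      { set      = above
      ; set∈     = λ ρ → up∈ (above-up ρ)
      ; antitone = λ { {σ} {τ} (i , refl) → above-antitone σ τ (prefix-∷ʳ (value σ) i) }
      ; covers   = λ x →
          let (T , placed , test) = root∈above (proj₂ (singleton-fits n C A x))
              h = homs T (placement⇒≤ₕ n C A T (proj₁ placed))
          in proj₁ h (root T) , test h
      }

    -- Since `x` is in `above ρ`, the test tree with root label `t` at `x` maps above `ρ`, its root
    -- to a node whose `above` set contains `x`. A node strictly above `ρ` would put `x` into the
    -- set of a child, so the root goes to `ρ` itself.
    above~-fits : ∀ {x t} ρ → x ∈ above ρ → x ∉ ⋃ (∃ (ρ ◂_)) (above ∘ proj₁) →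
      Fits C A t x → ≤𝒯 n t (label P ρ)
    above~-fits {x} {t} ρ x∈ x∉ t-fits with root∈above t-fits
    ... | T , placed@(_ , _ , refl) , test
      with x∈ T (placedAt⇒above T placed)
    ... | h@(ψ , _ , lab) , ρ⊑ with ψ (root T) | lab (root T) | test h | prefix-split (ρ⊑ (root T))
    ... | _ | t≤ | _ | inj₁ refl = t≤
    ... | (σ , [ σ∈ ]) | _ | x∈σ | inj₂ (i , ρi⊑σ) = ⊥-elim (x∉
      -- The child is a nonempty prefix of the node `σ`, hence a node, in forests as well as in
      -- trees.
      ( (((value ρ ∷ʳ i) , [ closed (∷ʳ-nonempty (value ρ)) ρi⊑σ σ∈ ]) , i , refl)
      , above-antitone (_ , [ closed (∷ʳ-nonempty (value ρ)) ρi⊑σ σ∈ ]) (σ , [ σ∈ ]) ρi⊑σ x∈σ ))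

-- The base need only contain the up-sets: in the induction it is a restriction of `L`, not
-- literally a base of up-sets. Likewise `P` is the given forest first and a label tree afterwards.
complete : ExcludedMiddle a → ∀ n (C : NPreorder a (suc n)) (A : Carrier C → Fin k)
  (P : Labelled (𝒯 k n)) → ClosedUnderNonemptyPrefixes P →
  ((T : 𝒯 k (suc n)) → T ≤ₕ⟨ C , A ⟩ → Hom (≤𝒯 n) ⌊ T ⌋ᵗ P) →
  (L : NBase ℓ (Carrier C) (suc n)) → (∀ i {X} → X ∈ UpSet C i → X ∈ family L i) →
  ∃[ 𝒰 ] Determines L P 𝒰 A
complete em zero C A P closed homs L up∈ = aboveCover em C A P closed homs (up∈ zero) ,
  λ ρ (x∈ , x∉) → above~-fits em C A P closed homs ρ x∈ x∉ (lift refl)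
complete {k = k} em (suc n) C A P closed homs L up∈ =
  (𝒰 , λ ρ → proj₁ (inner ρ)) , λ ρ → proj₂ (inner ρ)
  where
  open NPreorder C
  𝒰 = aboveCover em C A P closed homs (up∈ zero)
  open Cover 𝒰

  set~-≈ : ∀ {x y} ρ → x ≈[ zero ] y → x ∈ set~ ρ → y ∈ set~ ρ
  set~-≈ ρ (x≤y , y≤x) (x∈ , x∉) = above-up em C A P ρ x≤y x∈ ,
    λ { (τ , y∈) → x∉ (τ , above-up em C A P (proj₁ τ) y≤x y∈) }

  inner : ∀ ρ → ∃[ 𝒱 ] Determines (restrict L (set~ ρ)) ⌊ label P ρ ⌋ᵗ 𝒱 (A ∘ proj₁)
  inner ρ = complete em n (subPreorder C (set~ ρ)) (A ∘ proj₁) ⌊ label P ρ ⌋ᵗ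
    (treeClosed (label P ρ))
    (λ T h → let (x , (x∈ , x∉) , T-fits) = subPreorder-fits n C A (set~ ρ) T h
             in above~-fits em C A P closed homs ρ x∈ x∉ T-fits)
    (restrict L (set~ ρ))
    (λ i {X} up →
        (λ x → Σ[ x∈ ∈ x ∈ set~ ρ ] X (x , x∈))
      -- An up-set inside the reduced set is also one in `C`, because the relation at level `suc i`
      -- never leaves an `≈[ zero ]`-class.
      , up∈ (suc i) (λ { x≤y (x∈ , Xx) → set~-≈ ρ (≤⇒≈₀ C i x≤y) x∈ , up x≤y Xx })
      , (λ { {x , x∈} Xx → x∈ , Xx })
      -- Reflexivity serves to exchange the proof that the point lies in `set~ ρ`.
      , (λ { (_ , Xx) → up (IsPreorder.refl (isPreorder (suc i))) Xx }))

theorem3p8 : ∀ {a} → ExcludedMiddle a →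
    (n k : ℕ) → 2 ≤ k →
    (C : NPreorder a (suc n)) (A : NPreorder.Carrier C → Fin k) (F : 𝓕 k (suc n)) →
    A ∈ 𝒞⟨ C ⟩ F ⇔ ((T : 𝒯 k (suc n)) → T ≤ₕ⟨ C , A ⟩ → T ≤ₕ F)
theorem3p8 em n k _ C A F = mk⇔
  (λ (𝒰 , det) → sound em n (upSets C) ⌊ F ⌋ᶠ 𝒰 A det C id (λ i up → up))
  (λ homs → complete em n C A ⌊ F ⌋ᶠ (Forest.closed F) homs (upSets C) (λ i up → up))
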